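{- Let $P(5,1)$ be the graph with vertex set $\{u_0,\dots,u_4,v_0,\dots,v_4\}$ and edges $u_iu_{i+1}$, $v_iv_{i+1}$, $u_iv_i$ ($i=0,\dots,4$, indices mod $5$). Up to switching isomorphism there are exactly twelve signed graphs on $P(5,1)$; i.e., the set of all signatures $\Sigma\subseteq E(P(5,1))$ falls into exactly twelve classes under switching isomorphism.
   Context: A signature of a graph $G$ is a subset $\Sigma\subseteq E(G)$ (the negative edges). Resigning at a vertex $v$ replaces $\Sigma$ by its symmetric difference with the set of edges incident with $v$; two signatures are switching equivalent if one is obtained from the other by a sequence of resignings. Two signatures $\Sigma_1,\Sigma_2$ of $G$ are switching isomorphic if there is an automorphism $\psi$ of $G$ such that $\psi(\Sigma_1)=\{\psi(x)\psi(y):xy\in\Sigma_1\}$ is switching equivalent to $\Sigma_2$. -}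

module Defs where

open import Data.Bool using (Bool; true; false; _∨_; _xor_)
open import Data.Fin using (Fin; zero; suc)
open import Data.Fin.Properties using () renaming (_≟_ to _≟F_)
open import Data.Product using (Σ; Σ-syntax; ∃; _×_; _,_; proj₁; proj₂)
open import Data.Sum using (_⊎_)
open import Function.Bundles using (_↔_; Inverse; _⇔_)
open import Relation.Nullary.Decidable using (⌊_⌋)
open import Relation.Binary.PropositionalEquality using (_≡_)
open import Relation.Binary.Construct.Closure.ReflexiveTransitive using (Star)

next : Fin 5 → Fin 5
next zero = suc zero
next (suc zero) = suc (suc zero)
next (suc (suc zero)) = suc (suc (suc zero))
next (suc (suc (suc zero))) = suc (suc (suc (suc zero)))
next (suc (suc (suc (suc zero)))) = zero

data Vertex : Set where
  u : Fin 5 → Vertex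
  v : Fin 5 → Vertex

data Edge : Set where
  uu : Fin 5 → Edge
  vv : Fin 5 → Edge
  uv : Fin 5 → Edge

ends : Edge → Vertex × Vertex
ends (uu i) = u i , u (next i)
ends (vv i) = v i , v (next i)
ends (uv i) = u i , v i

Joins : Edge → Vertex → Vertex → Set
Joins e x y = (ends e ≡ (x , y)) ⊎ (ends e ≡ (y , x))

Adj : Vertex → Vertex → Set
Adj x y = ∃ λ e → Joins e x y

record Aut : Set where
  field
    perm : Vertex ↔ Vertex
  open Inverse perm public using (to)
  field
    preserves : ∀ x y → Adj x y ⇔ Adj (to x) (to y)

-- a signature: the set of negative edges, as a characteristic function
Sig : Set
Sig = Edge → Bool

eqV : Vertex → Vertex → Bool
eqV (u i) (u j) = ⌊ i ≟F j ⌋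
eqV (v i) (v j) = ⌊ i ≟F j ⌋
eqV (u _) (v _) = false
eqV (v _) (u _) = false

incident : Vertex → Edge → Bool
incident w e = eqV w (proj₁ (ends e)) ∨ eqV w (proj₂ (ends e))

ResignAt : Vertex → Sig → Sig → Set
ResignAt w s s' = ∀ e → s' e ≡ (s e xor incident w e)

Resign : Sig → Sig → Set
Resign s s' = Σ[ w ∈ Vertex ] ResignAt w s s'

SwitchEq : Sig → Sig → Set
SwitchEq = Star Resign

InImage : Aut → Sig → Edge → Set
InImage ψ s e' = Σ[ e ∈ Edge ] (s e ≡ true ×
  Joins e' (Aut.to ψ (proj₁ (ends e))) (Aut.to ψ (proj₂ (ends e))))

SwitchIso : Sig → Sig → Set
SwitchIso s₁ s₂ = Σ[ ψ ∈ Aut ] Σ[ s ∈ Sig ]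
  ((∀ e → (s e ≡ true) ⇔ InImage ψ s₁ e) × SwitchEq s s₂)

{-# OPTIONS --safe #-}
-- A signature is determined up to switching by the signs of the five squares and of the outer
-- pentagon, and rotations together with the exchange of the two pentagons bring these six signs
-- to one of twelve normal forms.  Conversely, the trace of a power of the signed adjacency matrix
-- is invariant under switching isomorphism; the traces of the 4th, 5th and 6th powers amount to the
-- numbers of negative 4-, 5- and 6-cycles and separate the twelve normal forms.
module Submission where

open import Defs
open import Data.Bool using (Bool; true; false; _∧_; _∨_; _xor_; if_then_else_)
open import Data.Bool.Properties as Bool
  using (⇔→≡; xor-same; xor-comm; xor-identityʳ; ∨-identityʳ; ∧-zeroʳ; ∧-identityʳ)
open import Data.Bool.Solver using (module xor-∧-Solver)
open import Data.Fin using (Fin; zero; suc; toℕ)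
open import Data.Fin.Properties using (_≟_; all?; any?; +↔⊎)
open import Data.Integer using (ℤ; +_; -_; _+_; 0ℤ; 1ℤ)
open import Data.Integer.Properties as ℤ using (+-0-commutativeMonoid; neg-distrib-+; neg-involutive)
open import Data.List using (List; []; _∷_; foldr)
open import Data.Maybe using (Maybe; just; nothing; maybe′)
import Data.Maybe as Maybe
open import Data.Maybe.Properties using (just-injective)
open import Data.Nat using (ℕ; zero; suc)
open import Data.Nat.GeneralisedArithmetic using (fold)
open import Data.Product using (Σ; Σ-syntax; ∃; _×_; _,_; proj₁; proj₂)
open import Data.Product.Properties using (,-injectiveˡ; ,-injectiveʳ; ≡-dec)
open import Data.Sum using (inj₁; inj₂; [_,_]′)
open import Data.Vec using (Vec; []; _∷_; lookup; tabulate)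
import Data.Vec.Properties as Vec
open import Function using (_∘_; id)
open import Function.Bundles using (_↔_; Inverse; _⇔_; mk⇔; mk↔ₛ′; Equivalence)
open import Function.Construct.Composition using (_↔-∘_)
open import Function.Construct.Symmetry using (↔-sym)
open import Relation.Binary.Construct.Closure.ReflexiveTransitive using (ε; _◅_)
open import Relation.Binary.PropositionalEquality
open import Relation.Nullary.Decidable using (Dec; yes; no; ⌊_⌋; from-yes; map′; _×-dec_; _→-dec_)
open import Relation.Nullary.Negation using (contradiction)

open import Algebra.Properties.CommutativeMonoid.Sum +-0-commutativeMonoid
  using (sum; sum-cong-≗; sum-permute)

private
  pattern one   = suc zero
  pattern two   = suc one
  pattern three = suc two
  pattern four  = suc three

open Aut
open Inverse using (strictlyInverseˡ; strictlyInverseʳ)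

-- Edges of the prism and the vertex pairs they join

source target : Edge → Vertex
source e = proj₁ (ends e)
target e = proj₂ (ends e)

Joins-sym : ∀ {e x y} → Joins e x y → Joins e y x
Joins-sym (inj₁ p) = inj₂ p
Joins-sym (inj₂ p) = inj₁ p

Joins-ends : ∀ {e e' x y} (φ : Vertex → Vertex) → Joins e x y →
             Joins e' (φ x) (φ y) → Joins e' (φ (source e)) (φ (target e))
Joins-ends φ (inj₁ refl) j = j
Joins-ends φ (inj₂ refl) j = Joins-sym j

arc? : Fin 5 → Fin 5 → Maybe (Fin 5)
arc? i j = if ⌊ j ≟ next i ⌋ then just i else if ⌊ i ≟ next j ⌋ then just j else nothing

-- A computable form of `Joins`, so that matrix entries evaluate at concrete vertices.
edge? : Vertex → Vertex → Maybe Edge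
edge? (u i) (u j) = Maybe.map uu (arc? i j)
edge? (v i) (v j) = Maybe.map vv (arc? i j)
edge? (u i) (v j) = if ⌊ i ≟ j ⌋ then just (uv i) else nothing
edge? (v i) (u j) = if ⌊ i ≟ j ⌋ then just (uv i) else nothing

edge?-sound : ∀ x y {e} → edge? x y ≡ just e → Joins e x y
edge?-sound (u i) (u j) p with j ≟ next i | i ≟ next j | p
... | yes refl | _        | refl = inj₁ refl
... | no _     | yes refl | refl = inj₂ refl
edge?-sound (v i) (v j) p with j ≟ next i | i ≟ next j | p
... | yes refl | _        | refl = inj₁ refl
... | no _     | yes refl | refl = inj₂ refl
edge?-sound (u i) (v j) p with i ≟ j | p
... | yes refl | refl = inj₁ refl
edge?-sound (v i) (u j) p with i ≟ j | p
... | yes refl | refl = inj₂ refl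

arc?-next : ∀ i → arc? i (next i) ≡ just i × arc? (next i) i ≡ just i
arc?-next zero = refl , refl
arc?-next one = refl , refl
arc?-next two = refl , refl
arc?-next three = refl , refl
arc?-next four = refl , refl

edge?-diagonal : ∀ i → (if ⌊ i ≟ i ⌋ then just (uv i) else nothing) ≡ just (uv i)
edge?-diagonal i with i ≟ i
... | yes _ = refl
... | no i≢i = contradiction refl i≢i

edge?-complete : ∀ {e x y} → Joins e x y → edge? x y ≡ just e
edge?-complete {uu i} (inj₁ refl) = cong (Maybe.map uu) (proj₁ (arc?-next i))
edge?-complete {uu i} (inj₂ refl) = cong (Maybe.map uu) (proj₂ (arc?-next i))
edge?-complete {vv i} (inj₁ refl) = cong (Maybe.map vv) (proj₁ (arc?-next i))
edge?-complete {vv i} (inj₂ refl) = cong (Maybe.map vv) (proj₂ (arc?-next i))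
edge?-complete {uv i} (inj₁ refl) = edge?-diagonal i
edge?-complete {uv i} (inj₂ refl) = edge?-diagonal i

-- The prism has no parallel edges: both edges are the value of the function `edge?` at the same
-- pair.
Joins-unique : ∀ {e e' x y} → Joins e x y → Joins e' x y → e ≡ e'
Joins-unique j j' = just-injective (trans (sym (edge?-complete j)) (edge?-complete j'))

-- Invariance of the traces of powers of the signed adjacency matrix

negateIf : Bool → ℤ → ℤ
negateIf b n = if b then - n else n

negateIf-xor : ∀ a b n → negateIf (a xor b) n ≡ negateIf a (negateIf b n)
negateIf-xor false b     n = refl
negateIf-xor true  false n = refl
negateIf-xor true  true  n = sym (neg-involutive n)

sum-negateIf : ∀ b {n} (f : Fin n → ℤ) → sum (negateIf b ∘ f) ≡ negateIf b (sum f)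
sum-negateIf false f = refl
sum-negateIf true {zero}  f = refl
sum-negateIf true {suc n} f =
  trans (cong (λ z → - f zero + z) (sum-negateIf true (f ∘ suc))) (sym (neg-distrib-+ (f zero) _))

vertices : Fin 10 ↔ Vertex
vertices = mk↔ₛ′ [ u , v ]′ (λ { (u i) → inj₁ i ; (v i) → inj₂ i })
             (λ { (u i) → refl ; (v i) → refl }) (λ { (inj₁ i) → refl ; (inj₂ i) → refl })
           ↔-∘ +↔⊎ {5} {5}

sumV : (Vertex → ℤ) → ℤ
sumV f = sum (f ∘ Inverse.to vertices)

sumV-cong : ∀ {f g : Vertex → ℤ} → (∀ x → f x ≡ g x) → sumV f ≡ sumV g
sumV-cong f≗g = sum-cong-≗ (f≗g ∘ Inverse.to vertices)

sumV-permute : ∀ (π : Vertex ↔ Vertex) f → sumV f ≡ sumV (f ∘ Inverse.to π)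
sumV-permute π f =
  trans (sum-permute (f ∘ Inverse.to vertices) (↔-sym vertices ↔-∘ (π ↔-∘ vertices)))
        (sum-cong-≗ (λ i → cong f (strictlyInverseˡ vertices (Inverse.to π (Inverse.to vertices i)))))

-- Multiplication by the (x , y) entry of the signed adjacency matrix.  It is not written as a
-- product in ℤ so that evaluation does not descend into the factor when the entry is 0.
entry : Sig → Vertex → Vertex → ℤ → ℤ
entry s x y n = maybe′ (λ e → negateIf (s e) n) 0ℤ (edge? x y)

-- The (x , y) entry of the (k + 1)-st power of the signed adjacency matrix.
walks : Sig → ℕ → Vertex → Vertex → ℤ
walks s zero    x y = entry s x y 1ℤ
walks s (suc k) x y = sumV (λ z → entry s x z (walks s k z y))

-- The trace of the (k + 1)-st power, that is, the signed count of closed walks of length k + 1.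
closedWalks : Sig → ℕ → ℤ
closedWalks s k = sumV (λ x → walks s k x x)

module _ (ψ : Aut) {s₁ s : Sig} (image : ∀ e → (s e ≡ true) ⇔ InImage ψ s₁ e) where

  to-injective : ∀ {x y} → to ψ x ≡ to ψ y → x ≡ y
  to-injective {x} {y} p =
    trans (sym (strictlyInverseʳ (perm ψ) x))
          (trans (cong (Inverse.from (perm ψ)) p) (strictlyInverseʳ (perm ψ) y))

  -- Both hypotheses describe the ends of `e'`, so the two image pairs agree up to order;
  -- injectivity carries this back to `x`, `y` and the ends of `e`.
  Joins-reflect : ∀ {e e' x y} → Joins e' (to ψ x) (to ψ y) →
                  Joins e' (to ψ (source e)) (to ψ (target e)) → Joins e x y
  Joins-reflect (inj₁ p) (inj₁ q) with trans (sym q) p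
  ... | r = inj₁ (cong₂ _,_ (to-injective (,-injectiveˡ r)) (to-injective (,-injectiveʳ r)))
  Joins-reflect (inj₁ p) (inj₂ q) with trans (sym q) p
  ... | r = inj₂ (cong₂ _,_ (to-injective (,-injectiveʳ r)) (to-injective (,-injectiveˡ r)))
  Joins-reflect (inj₂ p) (inj₁ q) with trans (sym q) p
  ... | r = inj₂ (cong₂ _,_ (to-injective (,-injectiveˡ r)) (to-injective (,-injectiveʳ r)))
  Joins-reflect (inj₂ p) (inj₂ q) with trans (sym q) p
  ... | r = inj₁ (cong₂ _,_ (to-injective (,-injectiveʳ r)) (to-injective (,-injectiveˡ r)))

  -- `InImage` only yields some negative edge `e₂` mapped onto `e'`; reflection and the absence of
  -- parallel edges force it to be `e`.
  image-sign : ∀ {e e' x y} → Joins e x y → Joins e' (to ψ x) (to ψ y) → s e' ≡ s₁ e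
  image-sign {e} {e'} j j' = ⇔→≡ (mk⇔ forward backward)
    where
    forward : s e' ≡ true → s₁ e ≡ true
    forward p with Equivalence.to (image e') p
    ... | e₂ , neg , j₂ = trans (cong s₁ (Joins-unique j (Joins-reflect j' j₂))) neg
    backward : s₁ e ≡ true → s e' ≡ true
    backward p = Equivalence.from (image e') (e , p , Joins-ends (to ψ) j j')

  entry-image : ∀ x y n → entry s (to ψ x) (to ψ y) n ≡ entry s₁ x y n
  entry-image x y n with edge? x y in p
  ... | just e with Equivalence.to (preserves ψ x y) (e , edge?-sound x y p)
  ...   | e' , j' rewrite edge?-complete j' =
          cong (λ b → negateIf b n) (image-sign (edge?-sound x y p) j')
  -- A non-edge must go to a non-edge: an edge between the images would pull back along `preserves`.
  entry-image x y n | nothing with edge? (to ψ x) (to ψ y) in q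
  ... | nothing = refl
  ... | just e' with Equivalence.from (preserves ψ x y) (e' , edge?-sound _ _ q)
  ...   | e , j = contradiction (trans (sym p) (edge?-complete j)) (λ ())

  walks-image : ∀ k x y → walks s k (to ψ x) (to ψ y) ≡ walks s₁ k x y
  walks-image zero    x y = entry-image x y 1ℤ
  walks-image (suc k) x y =
    -- The intermediate vertex is reindexed by `ψ`.
    trans (sumV-permute (perm ψ) (λ z → entry s (to ψ x) z (walks s k z (to ψ y))))
          (sumV-cong {g = λ z → entry s₁ x z (walks s₁ k z y)} λ z →
            trans (entry-image x z _) (cong (entry s₁ x z) (walks-image k z y)))

  closedWalks-image : ∀ k → closedWalks s k ≡ closedWalks s₁ k
  closedWalks-image k =
    trans (sumV-permute (perm ψ) (λ x → walks s k x x))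
          (sumV-cong {g = λ x → walks s₁ k x x} (λ x → walks-image k x x))

-- Invariance under resigning

next-≟ : ∀ i j → ⌊ i ≟ j ⌋ ∨ ⌊ i ≟ next j ⌋ ≡ ⌊ i ≟ j ⌋ xor ⌊ i ≟ next j ⌋
next-≟ = from-yes (all? λ i → all? λ j →
  (⌊ i ≟ j ⌋ ∨ ⌊ i ≟ next j ⌋) Bool.≟ (⌊ i ≟ j ⌋ xor ⌊ i ≟ next j ⌋))

-- No edge is a loop, so the two disjuncts never hold together. The `xor` form exhibits incidence
-- with `w` as the coboundary of the indicator of `w`.
incident-xor : ∀ w e → incident w e ≡ eqV w (source e) xor eqV w (target e)
incident-xor (u i) (uu j) = next-≟ i j
incident-xor (u i) (vv j) = refl
incident-xor (u i) (uv j) = trans (∨-identityʳ _) (sym (xor-identityʳ _))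
incident-xor (v i) (uu j) = refl
incident-xor (v i) (vv j) = next-≟ i j
incident-xor (v i) (uv j) = refl

incident-joins : ∀ w {e x y} → Joins e x y → incident w e ≡ eqV w x xor eqV w y
incident-joins w {e} (inj₁ refl) = incident-xor w e
incident-joins w {e} (inj₂ refl) = trans (incident-xor w e) (xor-comm (eqV w (source e)) _)

module _ {w s s'} (resign : ResignAt w s s') where

  -- Resigning at `w` conjugates the matrix by the diagonal matrix with -1 at `w` and 1 elsewhere.
  entry-resign : ∀ x y n →
    entry s' x y n ≡ negateIf (eqV w x xor eqV w y) (entry s x y n)
  entry-resign x y n with edge? x y in p
  ... | nothing = sym (negateIf-0 (eqV w x xor eqV w y))
    where
    negateIf-0 : ∀ b → negateIf b 0ℤ ≡ 0ℤ
    negateIf-0 false = refl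
    negateIf-0 true  = refl
  ... | just e rewrite resign e | incident-joins w (edge?-sound x y p)
                     | xor-comm (s e) (eqV w x xor eqV w y) =
    negateIf-xor (eqV w x xor eqV w y) (s e) n

  -- Conjugation passes to powers: the two signs at the intermediate vertex `z` cancel, by
  -- `telescope`.
  walks-resign : ∀ k x y → walks s' k x y ≡ negateIf (eqV w x xor eqV w y) (walks s k x y)
  walks-resign zero    x y = entry-resign x y 1ℤ
  walks-resign (suc k) x y =
    trans (sumV-cong {g = negateIf (eqV w x xor eqV w y) ∘ λ z → entry s x z (walks s k z y)} step)
          (sum-negateIf (eqV w x xor eqV w y) ((λ z → entry s x z (walks s k z y)) ∘ Inverse.to vertices))
    where
    entry-negateIf : ∀ b x y n → entry s x y (negateIf b n) ≡ negateIf b (entry s x y n)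
    entry-negateIf false x y n = refl
    entry-negateIf true  x y n with edge? x y
    ... | nothing = refl
    ... | just e with s e
    ...   | false = refl
    ...   | true  = refl
    telescope : ∀ a b c → (a xor b) xor (b xor c) ≡ a xor c
    telescope = solve 3 (λ a b c → (a :+ b) :+ (b :+ c) := a :+ c) refl
      where open xor-∧-Solver
    step : ∀ z → entry s' x z (walks s' k z y)
               ≡ negateIf (eqV w x xor eqV w y) (entry s x z (walks s k z y))
    step z = begin
      entry s' x z (walks s' k z y)
        ≡⟨ entry-resign x z _ ⟩
      negateIf (eqV w x xor eqV w z) (entry s x z (walks s' k z y))
        ≡⟨ cong (negateIf (eqV w x xor eqV w z) ∘ entry s x z) (walks-resign k z y) ⟩
      negateIf (eqV w x xor eqV w z) (entry s x z (negateIf (eqV w z xor eqV w y) (walks s k z y)))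
        ≡⟨ cong (negateIf (eqV w x xor eqV w z)) (entry-negateIf (eqV w z xor eqV w y) x z _) ⟩
      negateIf (eqV w x xor eqV w z) (negateIf (eqV w z xor eqV w y) (entry s x z (walks s k z y)))
        ≡⟨ negateIf-xor (eqV w x xor eqV w z) _ _ ⟨
      negateIf ((eqV w x xor eqV w z) xor (eqV w z xor eqV w y)) (entry s x z (walks s k z y))
        ≡⟨ cong (λ b → negateIf b _) (telescope (eqV w x) (eqV w z) (eqV w y)) ⟩
      negateIf (eqV w x xor eqV w y) (entry s x z (walks s k z y)) ∎
      where open ≡-Reasoning

  closedWalks-resign : ∀ k → closedWalks s' k ≡ closedWalks s k
  closedWalks-resign k = sumV-cong {g = λ x → walks s k x x} λ x →
    trans (walks-resign k x x) (cong (λ b → negateIf b (walks s k x x)) (xor-same (eqV w x)))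

closedWalks-SwitchEq : ∀ {s s'} → SwitchEq s s' → ∀ k → closedWalks s k ≡ closedWalks s' k
closedWalks-SwitchEq ε _ = refl
closedWalks-SwitchEq ((w , r) ◅ rs) k =
  trans (sym (closedWalks-resign {w} r k)) (closedWalks-SwitchEq rs k)

closedWalks-SwitchIso : ∀ {s s'} → SwitchIso s s' → ∀ k → closedWalks s k ≡ closedWalks s' k
closedWalks-SwitchIso (ψ , _ , image , switch) k =
  trans (sym (closedWalks-image ψ image k)) (closedWalks-SwitchEq switch k)

-- Signatures up to switching

square : Sig → Fin 5 → Bool
square s i = ((s (uu i) xor s (vv i)) xor s (uv i)) xor s (uv (next i))

-- The running sum along the outer pentagon, starting from u₀.
partial : Sig → Fin 5 → Bool
partial s zero  = false
partial s one   = s (uu zero)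
partial s two   = s (uu zero) xor s (uu one)
partial s three = (s (uu zero) xor s (uu one)) xor s (uu two)
partial s four  = ((s (uu zero) xor s (uu one)) xor s (uu two)) xor s (uu three)

outer : Sig → Bool
outer s = partial s four xor s (uu four)

Charge : Set
Charge = Vec Bool 6

-- The signs of a basis of the cycle space, whose dimension is 15 - 10 + 1 = 6.
charge : Sig → Charge
charge s = outer s ∷ tabulate (square s)

-- `ε` would need `s` and `r` equal as functions. Resigning twice at one vertex avoids this, since
-- `ResignAt` fixes its result only pointwise.
≗⇒SwitchEq : ∀ {s r : Sig} → (∀ e → s e ≡ r e) → SwitchEq s r
≗⇒SwitchEq {s} {r} s≗r =
  (u zero , λ _ → refl) ◅ (u zero , λ e → trans (sym (s≗r e)) (cancel (s e) (incident (u zero) e))) ◅ ε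
  where
  cancel : ∀ a b → a ≡ (a xor b) xor b
  cancel = solve 2 (λ a b → a := (a :+ b) :+ b) refl
    where open xor-∧-Solver

-- `incident w e` stands first in the conjunction so that, at a concrete edge, all terms but those
-- of its two ends vanish by evaluation even for abstract `f`.
resignings : (Vertex → Bool) → List Vertex → Edge → Bool
resignings f ws e = foldr (λ w b → (incident w e ∧ f w) xor b) false ws

resignings-SwitchEq : ∀ f ws {s r : Sig} →
  (∀ e → s e xor resignings f ws e ≡ r e) → SwitchEq s r
resignings-SwitchEq f [] p = ≗⇒SwitchEq (λ e → trans (sym (xor-identityʳ _)) (p e))
resignings-SwitchEq f (w ∷ ws) {s} p with f w
... | false = resignings-SwitchEq f ws λ e →
  trans (cong (λ b → s e xor (b xor resignings f ws e)) (sym (∧-zeroʳ (incident w e)))) (p e)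
... | true = (w , λ _ → refl) ◅ resignings-SwitchEq f ws λ e →
  trans (Bool.xor-assoc (s e) _ _)
        (trans (cong (λ b → s e xor (b xor resignings f ws e)) (sym (∧-identityʳ (incident w e)))) (p e))

allVertices : List Vertex
allVertices = u zero ∷ u one ∷ u two ∷ u three ∷ u four
            ∷ v zero ∷ v one ∷ v two ∷ v three ∷ v four ∷ []

resignings-coboundary : ∀ f e → resignings f allVertices e ≡ f (source e) xor f (target e)
resignings-coboundary f = coboundary
  where
  open-pair : ∀ x y → f x xor (f y xor false) ≡ f x xor f y
  open-pair x y = cong (f x xor_) (xor-identityʳ (f y))
  -- For the edges closing a pentagon, the target precedes the source in `allVertices`.
  close-pair : ∀ x y → f x xor (f y xor false) ≡ f y xor f x
  close-pair x y = trans (open-pair x y) (xor-comm (f x) (f y))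
  coboundary : ∀ e → resignings f allVertices e ≡ f (source e) xor f (target e)
  coboundary (uu zero) = open-pair _ _
  coboundary (uu one) = open-pair _ _
  coboundary (uu two) = open-pair _ _
  coboundary (uu three) = open-pair _ _
  coboundary (uu four) = close-pair _ _
  coboundary (vv zero) = open-pair _ _
  coboundary (vv one) = open-pair _ _
  coboundary (vv two) = open-pair _ _
  coboundary (vv three) = open-pair _ _
  coboundary (vv four) = close-pair _ _
  coboundary (uv zero) = open-pair _ _
  coboundary (uv one) = open-pair _ _
  coboundary (uv two) = open-pair _ _
  coboundary (uv three) = open-pair _ _
  coboundary (uv four) = open-pair _ _

module _ (s r : Sig) (same : charge s ≡ charge r) where

  private
    open xor-∧-Solver

    -- The difference of the two signatures. Once it is a coboundary, resigning carries `s` to `r`.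
    t : Sig
    t e = s e xor r e

    xor-cancel : ∀ {a b} → a ≡ b → a xor b ≡ false
    xor-cancel {a} refl = xor-same a

    outer-balanced : false ≡ outer t
    outer-balanced = trans (sym (xor-cancel (cong (λ { (o ∷ _) → o }) same)))
      (solve 10 (λ a₀ a₁ a₂ a₃ a₄ b₀ b₁ b₂ b₃ b₄ →
           ((((a₀ :+ a₁) :+ a₂) :+ a₃) :+ a₄) :+ ((((b₀ :+ b₁) :+ b₂) :+ b₃) :+ b₄)
        := ((((a₀ :+ b₀) :+ (a₁ :+ b₁)) :+ (a₂ :+ b₂)) :+ (a₃ :+ b₃)) :+ (a₄ :+ b₄)) refl
        (s (uu zero)) (s (uu one)) (s (uu two)) (s (uu three)) (s (uu four))
        (r (uu zero)) (r (uu one)) (r (uu two)) (r (uu three)) (r (uu four)))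

    square-balanced : ∀ i → square t i ≡ false
    square-balanced i = trans
      (solve 8 (λ a b c d a' b' c' d' →
           (((a :+ a') :+ (b :+ b')) :+ (c :+ c')) :+ (d :+ d')
        := (((a :+ b) :+ c) :+ d) :+ (((a' :+ b') :+ c') :+ d')) refl
        (s (uu i)) (s (vv i)) (s (uv i)) (s (uv (next i)))
        (r (uu i)) (r (vv i)) (r (uv i)) (r (uv (next i))))
      (xor-cancel (trans (sym (Vec.lookup∘tabulate (square s) i))
                  (trans (cong (λ { (_ ∷ a) → lookup a i }) same)
                         (Vec.lookup∘tabulate (square r) i))))

    -- Integration of `t` from u₀ along the spanning tree formed by the outer path u₀ to u₄ and the
    -- five spokes.
    potential : Vertex → Bool
    potential (u i) = partial t i
    potential (v i) = partial t i xor t (uv i)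

    partial-next : ∀ i → partial t (next i) ≡ partial t i xor t (uu i)
    partial-next zero = refl
    partial-next one = refl
    partial-next two = refl
    partial-next three = refl
    partial-next four = outer-balanced

    -- Tree edges hold by construction. Each of the six remaining edges closes one balanced cycle:
    -- the outer pentagon for `uu four`, a square for each `vv i`.
    potential-coboundary : ∀ e → potential (source e) xor potential (target e) ≡ t e
    potential-coboundary (uu i) rewrite partial-next i =
      solve 2 (λ p a → p :+ (p :+ a) := a) refl (partial t i) (t (uu i))
    potential-coboundary (vv i) rewrite partial-next i = begin
      (partial t i xor t (uv i)) xor ((partial t i xor t (uu i)) xor t (uv (next i)))
        ≡⟨ solve 5 (λ p a b c d → (p :+ c) :+ ((p :+ a) :+ d) := (((a :+ b) :+ c) :+ d) :+ b) refl
             (partial t i) (t (uu i)) (t (vv i)) (t (uv i)) (t (uv (next i))) ⟩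
      square t i xor t (vv i)
        ≡⟨ cong (_xor t (vv i)) (square-balanced i) ⟩
      t (vv i) ∎
      where open ≡-Reasoning
    potential-coboundary (uv i) =
      solve 2 (λ p a → p :+ (p :+ a) := a) refl (partial t i) (t (uv i))

  charge-SwitchEq : SwitchEq s r
  charge-SwitchEq = resignings-SwitchEq potential allVertices λ e →
    trans (cong (s e xor_) (trans (resignings-coboundary potential e) (potential-coboundary e)))
          (solve 2 (λ a b → a :+ (a :+ b) := b) refl (s e) (r e))

-- Symmetries

-- An automorphism with an explicit action on edges, so that signatures can be composed with it and
-- their charges computed.
record Symmetry : Set where
  field
    vertex     : Vertex ↔ Vertex
    edge edge⁻ : Edge → Edge
    edge-edge⁻ : ∀ e → edge (edge⁻ e) ≡ e
    joins      : ∀ e → Joins (edge e) (Inverse.to vertex (source e)) (Inverse.to vertex (target e))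
    joins⁻     : ∀ e → Joins (edge⁻ e) (Inverse.from vertex (source e)) (Inverse.from vertex (target e))

Adj-map : (φ : Vertex → Vertex) (η : Edge → Edge) → (∀ e → Joins (η e) (φ (source e)) (φ (target e))) →
          ∀ {x y} → Adj x y → Adj (φ x) (φ y)
Adj-map φ η j (e , inj₁ refl) = η e , j e
Adj-map φ η j (e , inj₂ refl) = η e , Joins-sym (j e)

module _ (g : Symmetry) where
  open Symmetry g

  composeInverse : Aut → Aut
  perm (composeInverse ψ) = perm ψ ↔-∘ ↔-sym vertex
  preserves (composeInverse ψ) x y = mk⇔
    (λ a → Equivalence.to (preserves ψ _ _) (Adj-map (Inverse.from vertex) edge⁻ joins⁻ a))
    (λ a → subst₂ Adj (strictlyInverseˡ vertex x) (strictlyInverseˡ vertex y)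
             (Adj-map (Inverse.to vertex) edge joins (Equivalence.from (preserves ψ _ _) a)))

  -- `s ∘ edge` is the preimage of `s` under g, so its image under ψ is the image of `s` under ψ
  -- after g⁻¹; the switching part is unchanged.
  SwitchIso-pullback : ∀ {s r} → SwitchIso (s ∘ edge) r → SwitchIso s r
  SwitchIso-pullback {s} (ψ , s' , image , switch) = composeInverse ψ , s' , image' , switch
    where
    image' : ∀ e → (s' e ≡ true) ⇔ InImage (composeInverse ψ) s e
    image' e = mk⇔ forward backward
      where
      forward : s' e ≡ true → InImage (composeInverse ψ) s e
      forward p with Equivalence.to (image e) p
      ... | e₀ , neg , j = edge e₀ , neg ,
        Joins-ends (to (composeInverse ψ)) (joins e₀)
          (subst₂ (λ x y → Joins e (to ψ x) (to ψ y))
            (sym (strictlyInverseʳ vertex (source e₀))) (sym (strictlyInverseʳ vertex (target e₀))) j)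
      backward : InImage (composeInverse ψ) s e → s' e ≡ true
      backward (e₁ , neg , j) = Equivalence.from (image e)
        (edge⁻ e₁ , trans (cong s (edge-edge⁻ e₁)) neg , Joins-ends (to ψ) (joins⁻ e₁) j)

charge-SwitchIso : ∀ s r → charge s ≡ charge r → SwitchIso s r
charge-SwitchIso s r same = identity , s , image , charge-SwitchEq s r same
  where
  identity : Aut
  perm identity = mk↔ₛ′ id id (λ _ → refl) (λ _ → refl)
  preserves identity x y = mk⇔ id id
  image : ∀ e → (s e ≡ true) ⇔ InImage identity s e
  image e = mk⇔ (λ p → e , p , inj₁ refl)
    (λ (e' , p , j) → trans (cong s (Joins-unique j (inj₁ refl))) p)

-- As a fourth power of `next`, it makes both composites with `next` the same term, and `next-prev`
-- serves for both inverse laws.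
prev : Fin 5 → Fin 5
prev i = next (next (next (next i)))

next-prev : ∀ i → next (prev i) ≡ i
next-prev zero = refl
next-prev one = refl
next-prev two = refl
next-prev three = refl
next-prev four = refl

rotation : Symmetry
rotation = record
  { vertex     = mk↔ₛ′ (λ { (u i) → u (next i) ; (v i) → v (next i) })
                       (λ { (u i) → u (prev i) ; (v i) → v (prev i) })
                       (λ { (u i) → cong u (next-prev i) ; (v i) → cong v (next-prev i) })
                       (λ { (u i) → cong u (next-prev i) ; (v i) → cong v (next-prev i) })
  ; edge       = λ { (uu i) → uu (next i) ; (vv i) → vv (next i) ; (uv i) → uv (next i) }
  ; edge⁻      = λ { (uu i) → uu (prev i) ; (vv i) → vv (prev i) ; (uv i) → uv (prev i) }
  ; edge-edge⁻ = λ { (uu i) → cong uu (next-prev i) ; (vv i) → cong vv (next-prev i)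
                   ; (uv i) → cong uv (next-prev i) }
  ; joins      = λ { (uu i) → inj₁ refl ; (vv i) → inj₁ refl ; (uv i) → inj₁ refl }
  ; joins⁻     = λ { (uu i) → inj₁ refl ; (vv i) → inj₁ refl ; (uv i) → inj₁ refl }
  }

exchange : Symmetry
exchange = record
  { vertex     = mk↔ₛ′ swapV swapV swapV-involutive swapV-involutive
  ; edge       = swapE
  ; edge⁻      = swapE
  ; edge-edge⁻ = λ { (uu i) → refl ; (vv i) → refl ; (uv i) → refl }
  ; joins      = swap-joins
  ; joins⁻     = swap-joins
  }
  where
  swapV : Vertex → Vertex
  swapV (u i) = v i
  swapV (v i) = u i
  swapV-involutive : ∀ x → swapV (swapV x) ≡ x
  swapV-involutive (u i) = refl
  swapV-involutive (v i) = refl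
  swapE : Edge → Edge
  swapE (uu i) = vv i
  swapE (vv i) = uu i
  swapE (uv i) = uv i
  swap-joins : ∀ e → Joins (swapE e) (swapV (source e)) (swapV (target e))
  swap-joins (uu i) = inj₁ refl
  swap-joins (vv i) = inj₁ refl
  swap-joins (uv i) = inj₂ refl

rotate flip : Charge → Charge
rotate (o ∷ a ∷ b ∷ c ∷ d ∷ e ∷ []) = o ∷ b ∷ c ∷ d ∷ e ∷ a ∷ []
-- The inner pentagon is the sum of the outer one and the five squares.
flip (o ∷ a ∷ b ∷ c ∷ d ∷ e ∷ []) =
  (o xor ((((a xor b) xor c) xor d) xor e)) ∷ a ∷ b ∷ c ∷ d ∷ e ∷ []

charge-rotation : ∀ s → charge (s ∘ Symmetry.edge rotation) ≡ rotate (charge s)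
charge-rotation s = cong (_∷ tabulate (square (s ∘ Symmetry.edge rotation)))
  (solve 5 (λ a b c d e → (((b :+ c) :+ d) :+ e) :+ a := (((a :+ b) :+ c) :+ d) :+ e) refl
     (s (uu zero)) (s (uu one)) (s (uu two)) (s (uu three)) (s (uu four)))
  where open xor-∧-Solver

-- In the sum of the five squares every spoke occurs twice and cancels, leaving the two pentagons.
charge-exchange : ∀ s → charge (s ∘ Symmetry.edge exchange) ≡ flip (charge s)
charge-exchange s = cong₂ _∷_
  (solve 15 (λ a b c d e a' b' c' d' e' f g h i j →
       (((a' :+ b') :+ c') :+ d') :+ e'
    := ((((a :+ b) :+ c) :+ d) :+ e)
       :+ (((((((a :+ a') :+ f) :+ g) :+ (((b :+ b') :+ g) :+ h)) :+ (((c :+ c') :+ h) :+ i))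
            :+ (((d :+ d') :+ i) :+ j)) :+ (((e :+ e') :+ j) :+ f))) refl
     (s (uu zero)) (s (uu one)) (s (uu two)) (s (uu three)) (s (uu four))
     (s (vv zero)) (s (vv one)) (s (vv two)) (s (vv three)) (s (vv four))
     (s (uv zero)) (s (uv one)) (s (uv two)) (s (uv three)) (s (uv four)))
  (Vec.tabulate-cong (λ i → cong (λ b → (b xor s (uv i)) xor s (uv (next i)))
                                 (xor-comm (s (vv i)) (s (uu i)))))
  where open xor-∧-Solver

-- The twelve classes

-- A signature with the given charge: spokes are positive, `uu zero` carries the outer sign, and
-- each inner edge corrects its square.
realise : Charge → Sig
realise (o ∷ a) (uu zero)    = o
realise (o ∷ a) (uu (suc i)) = false
realise (o ∷ a) (vv zero)    = o xor lookup a zero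
realise (o ∷ a) (vv (suc i)) = lookup a (suc i)
realise (o ∷ a) (uv i)       = false

private
  pattern O = false
  pattern I = true

-- The sign of the outer pentagon, then those of the five squares in cyclic order.
representatives : Vec Charge 12
representatives =
  (O ∷ O ∷ O ∷ O ∷ O ∷ O ∷ []) ∷
  (I ∷ O ∷ O ∷ O ∷ O ∷ O ∷ []) ∷
  (O ∷ I ∷ I ∷ O ∷ O ∷ O ∷ []) ∷
  (I ∷ I ∷ I ∷ O ∷ O ∷ O ∷ []) ∷
  (O ∷ I ∷ O ∷ I ∷ O ∷ O ∷ []) ∷
  (I ∷ I ∷ O ∷ I ∷ O ∷ O ∷ []) ∷
  (O ∷ I ∷ I ∷ I ∷ I ∷ O ∷ []) ∷
  (I ∷ I ∷ I ∷ I ∷ I ∷ O ∷ []) ∷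
  (O ∷ I ∷ O ∷ O ∷ O ∷ O ∷ []) ∷
  (O ∷ I ∷ I ∷ I ∷ O ∷ O ∷ []) ∷
  (O ∷ I ∷ I ∷ O ∷ I ∷ O ∷ []) ∷
  (O ∷ I ∷ I ∷ I ∷ I ∷ I ∷ []) ∷
  []

representative : Fin 12 → Sig
representative i = realise (lookup representatives i)

traces : Sig → ℤ × ℤ × ℤ
traces s = closedWalks s 3 , closedWalks s 4 , closedWalks s 5

traces-SwitchIso : ∀ {s s'} → SwitchIso s s' → traces s ≡ traces s'
traces-SwitchIso {s} {s'} iso = cong₂ _,_ (walks≡ 3) (cong₂ _,_ (walks≡ 4) (walks≡ 5))
  where
  walks≡ : ∀ k → closedWalks s k ≡ closedWalks s' k
  walks≡ = closedWalks-SwitchIso {s} {s'} iso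

-- The first entry is 190 less 16 per negative square; the second adds 10 or -10 for each pentagon.
-- Where these agree, the third tells consecutive negative squares from others through the 6-cycles
-- around two adjacent squares.
traceTable : Vec (ℤ × ℤ × ℤ) 12
traceTable =
  (+ 190 , + 20 , + 1410) ∷
  (+ 190 , - + 20 , + 1410) ∷
  (+ 158 , + 20 , + 978) ∷
  (+ 158 , - + 20 , + 978) ∷
  (+ 158 , + 20 , + 930) ∷
  (+ 158 , - + 20 , + 930) ∷
  (+ 126 , + 20 , + 594) ∷
  (+ 126 , - + 20 , + 594) ∷
  (+ 174 , + 0 , + 1170) ∷
  (+ 142 , + 0 , + 786) ∷
  (+ 142 , + 0 , + 738) ∷
  (+ 110 , + 0 , + 450) ∷
  []

traces-representative : ∀ i → traces (representative i) ≡ lookup traceTable i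
traces-representative i =
  trans (sym (Vec.lookup∘tabulate (traces ∘ representative) i)) (cong (λ t → lookup t i) table)
  -- For a variable `i` the traces do not evaluate, so all twelve triples are computed at once.
  where
  table : tabulate (traces ∘ representative) ≡ traceTable
  table = refl

traceTable-injective : ∀ i j → lookup traceTable i ≡ lookup traceTable j → i ≡ j
traceTable-injective =
  from-yes (all? λ i → all? λ j → (lookup traceTable i ≟ᵗ lookup traceTable j) →-dec (i ≟ j))
  where _≟ᵗ_ = ≡-dec ℤ._≟_ (≡-dec ℤ._≟_ ℤ._≟_)

representative-injective : ∀ i j → SwitchIso (representative i) (representative j) → i ≡ j
representative-injective i j iso = traceTable-injective i j
  (trans (sym (traces-representative i))
         (trans (traces-SwitchIso {representative i} {representative j} iso) (traces-representative j)))

-- Every signature reaches a representative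

allVec? : ∀ {n} {P : Vec Bool n → Set} → (∀ c → Dec (P c)) → Dec (∀ c → P c)
allVec? {zero}  P? = map′ (λ { p [] → p }) (λ f → f []) (P? [])
allVec? {suc n} P? =
  map′ (λ { (p , q) (false ∷ c) → p c ; (p , q) (true ∷ c) → q c })
       (λ f → (λ c → f (false ∷ c)) , (λ c → f (true ∷ c)))
       (allVec? (λ c → P? (false ∷ c)) ×-dec allVec? (λ c → P? (true ∷ c)))

InOrbitOf : Charge → Fin 12 → Fin 5 → Fin 2 → Set
InOrbitOf c i k l = fold (fold c flip (toℕ l)) rotate (toℕ k) ≡ charge (representative i)

-- An exhaustive check of the 64 charges. The square signs have eight rotation classes: the four
-- with evenly many negative squares leave the outer sign fixed under `flip` and give two orbits
-- each, the four odd ones give one each.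
orbits : ∀ c → ∃ λ i → ∃ λ k → ∃ λ l → InOrbitOf c i k l
orbits = from-yes (allVec? {P = λ c → ∃ λ i → ∃ λ k → ∃ λ l → InOrbitOf c i k l} λ c →
  any? λ i → any? λ k → any? λ l → Vec.≡-dec Bool._≟_ _ _)

Classified : Charge → Set
Classified c = ∀ s → charge s ≡ c → ∃ λ i → SwitchIso s (representative i)

-- Peels off one `f` at a time: composing a signature with `g` applies `f` to its charge, and the
-- isomorphism found there pulls back.
Classified-symmetry : ∀ (g : Symmetry) f → (∀ s → charge (s ∘ Symmetry.edge g) ≡ f (charge s)) →
                      ∀ n {c} → Classified (fold c f n) → Classified c
Classified-symmetry g f charge-g zero    p = p
Classified-symmetry g f charge-g (suc n) {c} p = Classified-symmetry g f charge-g n {c} λ s eq →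
  let i , iso = p (s ∘ Symmetry.edge g) (trans (charge-g s) (cong f eq))
  in i , SwitchIso-pullback g {s} {representative i} iso

orbit-Classified : ∀ c i k l → InOrbitOf c i k l → Classified c
orbit-Classified c i k l eq =
  -- `InOrbitOf` flips first and rotates afterwards, so the rotations are undone first.
  Classified-symmetry exchange flip charge-exchange (toℕ l) {c}
    (Classified-symmetry rotation rotate charge-rotation (toℕ k) {fold c flip (toℕ l)}
      (λ s eq' → i , charge-SwitchIso s (representative i) (trans eq' eq)))

classify : ∀ s → ∃ λ i → SwitchIso s (representative i)
classify s = let i , k , l , eq = orbits (charge s) in orbit-Classified (charge s) i k l eq s refl

theorem7 : Σ[ R ∈ (Fin 12 → Sig) ]
    ((∀ i j → SwitchIso (R i) (R j) → i ≡ j) × (∀ s → ∃ λ i → SwitchIso s (R i)))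
theorem7 = representative , representative-injective , classify
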